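{- There is an algorithm to decide, for an arbitrary given pair of communicating SR-machines neither of which has a send cycle, whether the protocol is (simultaneously) affine and deadlock-free.
   Context: A pair of communicating SR-machines is a CFSM protocol with communication graph having nodes $\{0,1\}$ and two edges $\alpha$ (from $0$ to $1$) and $\beta$ (from $1$ to $0$), disjoint finite message alphabets $M_\alpha,M_\beta$, and two finite state machines $F_j=(K_j,\Sigma_j,T_j,h_j)$, $j=0,1$, with $\Sigma_0=\{ -b:b\in M_\alpha\}\cup\{+b:b\in M_\beta\}$, $\Sigma_1=\{ -b:b\in M_\beta\}\cup\{+b:b\in M_\alpha\}$, $K_j$ finite, $h_j\in K_j$ initial, $T_j\subseteq K_j\times\Sigma_j\times K_j$ (transitions $p\xrightarrow{e}q$; $+b$ = receive, $-b$ = send; $p\xrightarrow{w}q$ means a directed path labelled $w$). A send state has no outgoing $+b$ transition, a receive state no outgoing $-b$ transition. $F_j$ is an SR-machine if every state is a send or a receive state, its transition diagram is strongly connected, and it is deterministic. Global states are $((p_0,p_1),(x_\alpha,x_\beta))$; initially $((h_0,h_1),(\lambda,\lambda))$. A step is a send (a machine performs $p\xrightarrow{ -b}q$ and $b$ is appended to its output channel: $\alpha$ for $F_0$, $\beta$ for $F_1$) or a receive (a machine performs $p\xrightarrow{+b}q$ and $b$ is removed from the front of its input channel, which must begin with $b$); the other machine is unchanged. A global state is deadlocked if both components are receive states and both channels are empty; deadlock-free means no reachable deadlocked global state. $\pi_\alpha(w)$ (resp. $\pi_\beta(w)$) is the string of $M_\alpha$- (resp. $M_\beta$-) symbols in $w$,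 in order, signs removed; $\mathbf Z_j=\{(\pi_\alpha(w),\pi_\beta(w)): h_j\xrightarrow{w}h_j\}$; the pair is affine if $\mathbf Z_0=\mathbf Z_1$. A send cycle of $F_j$ is a directed cycle in its transition diagram all of whose labels are of the form $-b$. -}

module Defs where

open import Data.Bool using (Bool; T)
open import Data.Fin using (Fin)
open import Data.List using (List; []; _∷_; _∷ʳ_)
open import Data.List.Relation.Unary.All using (All)
open import Data.Nat using (ℕ)
open import Data.Product using (∃; _×_; _,_)
open import Data.Sum using (_⊎_)
open import Function.Bundles using (_⇔_)
open import Relation.Binary.Construct.Closure.ReflexiveTransitive using (Star)
open import Relation.Binary.PropositionalEquality using (_≡_; _≢_)
open import Relation.Nullary using (¬_)

-- Labels of a machine whose output alphabet is Fin o and whose input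
-- alphabet is Fin i:  ‵- b  is "send b",  ‵+ b  is "receive b".
-- Tagging keeps the two alphabets disjoint.
data Label (o i : ℕ) : Set where
  ‵-_ : Fin o → Label o i
  ‵+_ : Fin i → Label o i

sent : ∀ {o i} → List (Label o i) → List (Fin o)
sent []           = []
sent ((‵- b) ∷ w) = b ∷ sent w
sent ((‵+ b) ∷ w) = sent w

received : ∀ {o i} → List (Label o i) → List (Fin i)
received []           = []
received ((‵- b) ∷ w) = received w
received ((‵+ b) ∷ w) = b ∷ received w

data IsSend {o i : ℕ} : Label o i → Set where
  isSend : ∀ b → IsSend (‵- b)

-- The transition set is given by its characteristic function, so that a
-- machine is finite data.
record Machine (o i : ℕ) : Set where
  field
    size       : ℕ
    transition : Fin size → Label o i → Fin size → Bool
    initial    : Fin size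

  State : Set
  State = Fin size

  infix 4 _-[_]→_ _-[_]→*_

  _-[_]→_ : State → Label o i → State → Set
  p -[ e ]→ q = T (transition p e q)

  data _-[_]→*_ : State → List (Label o i) → State → Set where
    stop : ∀ {p} → p -[ [] ]→* p
    step : ∀ {p q r e w} → p -[ e ]→ q → q -[ w ]→* r → p -[ e ∷ w ]→* r

  SendState : State → Set
  SendState p = ∀ b q → ¬ (p -[ ‵+ b ]→ q)

  ReceiveState : State → Set
  ReceiveState p = ∀ b q → ¬ (p -[ ‵- b ]→ q)

  StronglyConnected : Set
  StronglyConnected = ∀ p q → ∃ λ w → p -[ w ]→* q

  Deterministic : Set
  Deterministic = ∀ p e q q′ → p -[ e ]→ q → p -[ e ]→ q′ → q ≡ q′

  record IsSR : Set where
    field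
      sendOrReceive     : ∀ p → SendState p ⊎ ReceiveState p
      stronglyConnected : StronglyConnected
      deterministic     : Deterministic

  HasSendCycle : Set
  HasSendCycle = ∃ λ p → ∃ λ w → w ≢ [] × All IsSend w × p -[ w ]→* p

-- M_α = Fin mα (channel from F₀ to F₁) and M_β = Fin mβ (from F₁ to F₀).
record Protocol : Set where
  field
    mα mβ : ℕ
    F₀    : Machine mα mβ
    F₁    : Machine mβ mα

  module F₀ = Machine F₀
  module F₁ = Machine F₁

  GlobalState : Set
  GlobalState = (F₀.State × F₁.State) × (List (Fin mα) × List (Fin mβ))

  initialState : GlobalState
  initialState = (F₀.initial , F₁.initial) , ([] , [])

  infix 4 _⟶_

  -- The head of a list is the front of the channel.
  data _⟶_ : GlobalState → GlobalState → Set where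
    send₀ : ∀ {p₀ q₀ p₁ b xα xβ} → p₀ F₀.-[ ‵- b ]→ q₀ →
            ((p₀ , p₁) , (xα , xβ)) ⟶ ((q₀ , p₁) , (xα ∷ʳ b , xβ))
    recv₀ : ∀ {p₀ q₀ p₁ b xα xβ} → p₀ F₀.-[ ‵+ b ]→ q₀ →
            ((p₀ , p₁) , (xα , b ∷ xβ)) ⟶ ((q₀ , p₁) , (xα , xβ))
    send₁ : ∀ {p₀ p₁ q₁ b xα xβ} → p₁ F₁.-[ ‵- b ]→ q₁ →
            ((p₀ , p₁) , (xα , xβ)) ⟶ ((p₀ , q₁) , (xα , xβ ∷ʳ b))
    recv₁ : ∀ {p₀ p₁ q₁ b xα xβ} → p₁ F₁.-[ ‵+ b ]→ q₁ →
            ((p₀ , p₁) , (b ∷ xα , xβ)) ⟶ ((p₀ , q₁) , (xα , xβ))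

  Reachable : GlobalState → Set
  Reachable = Star _⟶_ initialState

  Deadlocked : GlobalState → Set
  Deadlocked ((p₀ , p₁) , (xα , xβ)) =
    F₀.ReceiveState p₀ × F₁.ReceiveState p₁ × xα ≡ [] × xβ ≡ []

  DeadlockFree : Set
  DeadlockFree = ∀ g → Reachable g → ¬ Deadlocked g

  -- On labels of F₀, π_α is `sent` and π_β is `received`; on labels of F₁
  -- the roles are exchanged.
  Z₀ Z₁ : List (Fin mα) → List (Fin mβ) → Set
  Z₀ x y = ∃ λ w → F₀.initial F₀.-[ w ]→* F₀.initial × sent w ≡ x × received w ≡ y
  Z₁ x y = ∃ λ w → F₁.initial F₁.-[ w ]→* F₁.initial × received w ≡ x × sent w ≡ y

  Affine : Set
  Affine = ∀ x y → Z₀ x y ⇔ Z₁ x y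

{-# OPTIONS --safe #-}
module Submission where

-- An SR-machine reads the two channels as a deterministic two-tape automaton, so
-- affinity says that the two automata accept the same pairs of words. Affinity and
-- the absence of send cycles bound the channels in all reachable global states by a
-- computable constant. If the channels are bounded and no deadlock is reachable,
-- every loop of one machine can be replayed as a joint execution in which the other
-- machine imitates it; imitation can fail only locally, at one of finitely many
-- global states, in a way that is detected by reachability in finite graphs.

open import Data.Bool using (T?)
open import Data.Empty using (⊥)
open import Data.Fin using (Fin; zero; suc)
import Data.Fin as Fin
open import Data.Fin.Properties using (all?; any?; pigeonhole)
import Data.Fin.Properties as Finₚ
open import Data.List using (List; []; _∷_; _∷ʳ_; _++_; allFin; cartesianProduct; cartesianProductWith; head; length)
open import Data.List.Membership.Propositional using (_∈_)
open import Data.List.Membership.Propositional.Properties using (∈-allFin; ∈-cartesianProduct⁺; ∈-cartesianProductWith⁺)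
open import Data.List.Properties using (++-assoc; ++-identityʳ; ∷-injective; ∷ʳ-++; length-++; length-++-≤ʳ; length-++-sucʳ; ≡-dec)
open import Data.List.Relation.Unary.All using (All; []; _∷_)
import Data.List.Relation.Unary.All as All
import Data.List.Relation.Unary.All.Properties as Allₚ
open import Data.List.Relation.Unary.Any using (here; there)
open import Data.Maybe using (just)
import Data.Maybe.Properties as Maybeₚ
open import Data.Nat using (ℕ; zero; suc; _+_; _*_; _⊔_; _≤_; _<_; _≤?_; _<?_; z≤n; s≤s)
open import Data.Nat.Properties
open import Data.Product using (∃; _×_; _,_; proj₁; proj₂)
import Data.Product.Properties as Productₚ
open import Data.Sum using (_⊎_; inj₁; inj₂)
import Data.Sum as Sum
open import Function using (_∘_)
open import Function.Bundles using (mk⇔; Equivalence)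
open import Relation.Binary.Construct.Closure.ReflexiveTransitive using (Star; ε; _◅_; _◅◅_)
import Relation.Binary.Construct.Closure.ReflexiveTransitive as Star
open import Relation.Binary.Definitions using (Decidable; DecidableEquality)
open import Relation.Binary.PropositionalEquality using (_≡_; _≢_; refl; sym; trans; cong; subst; module ≡-Reasoning)
open import Relation.Nullary using (¬_; Dec; yes; no; contradiction)
open import Relation.Nullary.Decidable using (map′; _×-dec_; _⊎-dec_; _→-dec_; ¬?)
open import Defs

-- Finite search

finite-bound : ∀ {n} (f : Fin n → ℕ) → ∃ λ m → ∀ k → f k ≤ m
finite-bound {zero}  f = 0 , λ ()
finite-bound {suc n} f with finite-bound (f ∘ suc)
... | m , f≤m = f zero ⊔ m , λ where
  zero    → m≤m⊔n (f zero) m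
  (suc k) → ≤-trans (f≤m k) (m≤n⊔m (f zero) m)

module _ {A : Set} {E : A → A → Set} (_≟_ : DecidableEquality A) (E? : Decidable E) where

  -- Warshall's recursion on the set of permitted intermediate vertices.
  Via : List A → A → A → Set
  Via []       i j = i ≡ j ⊎ E i j
  Via (k ∷ ks) i j = Via ks i j ⊎ Via ks i k × Via ks k j

  via? : ∀ ks → Decidable (Via ks)
  via? []       i j = (i ≟ j) ⊎-dec E? i j
  via? (k ∷ ks) i j = via? ks i j ⊎-dec via? ks i k ×-dec via? ks k j

  via⇒star : ∀ ks {i j} → Via ks i j → Star E i j
  via⇒star []       (inj₁ refl)    = ε
  via⇒star []       (inj₂ e)       = e ◅ ε
  via⇒star (k ∷ ks) (inj₁ p)       = via⇒star ks p
  via⇒star (k ∷ ks) (inj₂ (p , q)) = via⇒star ks p ◅◅ via⇒star ks q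

  via-refl : ∀ ks {i} → Via ks i i
  via-refl []       = inj₁ refl
  via-refl (k ∷ ks) = inj₁ (via-refl ks)

  via-edge : ∀ ks {i j} → E i j → Via ks i j
  via-edge []       e = inj₂ e
  via-edge (k ∷ ks) e = inj₁ (via-edge ks e)

  -- The new edge is appended at the level of `ks` where `k` is added as an intermediate vertex; an
  -- initial detour from `k` back to `k` is dropped there.
  via-step : ∀ ks {i j k} → k ∈ ks → E i k → Via ks k j → Via ks i j
  via-step (k ∷ ks) (here refl) e (inj₁ p)       = inj₂ (via-edge ks e , p)
  via-step (k ∷ ks) (here refl) e (inj₂ (_ , p)) = inj₂ (via-edge ks e , p)
  via-step (k ∷ ks) (there k∈)  e (inj₁ p)       = inj₁ (via-step ks k∈ e p)
  via-step (k ∷ ks) (there k∈)  e (inj₂ (p , q)) = inj₂ (via-step ks k∈ e p , q)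

  -- Every intermediate vertex of a walk is the target of an edge, so listing the targets suffices
  -- even when the vertex type is infinite.
  star? : ∀ ks → (∀ {i j} → E i j → j ∈ ks) → Decidable (Star E)
  star? ks targets i j = map′ (via⇒star ks) star⇒via (via? ks i j)
    where
    star⇒via : ∀ {i j} → Star E i j → Via ks i j
    star⇒via ε       = via-refl ks
    star⇒via (e ◅ s) = via-step ks (targets e) e (star⇒via s)

lists≤ : ∀ n → ℕ → List (List (Fin n))
lists≤ n zero    = [] ∷ []
lists≤ n (suc l) = [] ∷ cartesianProductWith _∷_ (allFin n) (lists≤ n l)

∈-lists≤ : ∀ {n l} (x : List (Fin n)) → length x ≤ l → x ∈ lists≤ n l
∈-lists≤ {l = zero}  []      _         = here refl
∈-lists≤ {l = suc l} []      _         = here refl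
∈-lists≤ {l = suc l} (a ∷ x) (s≤s x≤l) = there (∈-cartesianProductWith⁺ _∷_ (∈-allFin a) (∈-lists≤ x x≤l))

length-∷ʳ : ∀ {A : Set} (a : A) x → length (x ∷ʳ a) ≡ suc (length x)
length-∷ʳ a x = trans (length-++-sucʳ x a []) (cong (suc ∘ length) (++-identityʳ x))

head-++ : ∀ {A : Set} {a : A} x y → head x ≡ just a → head (x ++ y) ≡ just a
head-++ (_ ∷ _) _ eq = eq

-- Paths of a single machine

sent-++ : ∀ {o i} (u v : List (Label o i)) → sent (u ++ v) ≡ sent u ++ sent v
sent-++ []           v = refl
sent-++ ((‵- b) ∷ u) v = cong (b ∷_) (sent-++ u v)
sent-++ ((‵+ b) ∷ u) v = sent-++ u v

received-++ : ∀ {o i} (u v : List (Label o i)) → received (u ++ v) ≡ received u ++ received v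
received-++ []           v = refl
received-++ ((‵- b) ∷ u) v = received-++ u v
received-++ ((‵+ b) ∷ u) v = cong (b ∷_) (received-++ u v)

length-sent≤ : ∀ {o i} (w : List (Label o i)) → length (sent w) ≤ length w
length-sent≤ []           = z≤n
length-sent≤ ((‵- b) ∷ w) = s≤s (length-sent≤ w)
length-sent≤ ((‵+ b) ∷ w) = m≤n⇒m≤1+n (length-sent≤ w)

length-received≤ : ∀ {o i} (w : List (Label o i)) → length (received w) ≤ length w
length-received≤ []           = z≤n
length-received≤ ((‵- b) ∷ w) = m≤n⇒m≤1+n (length-received≤ w)
length-received≤ ((‵+ b) ∷ w) = s≤s (length-received≤ w)

module _ {o i : ℕ} {M : Machine o i} where
  open Machine M

  path-++ : ∀ {p q r u v} → p -[ u ]→* q → q -[ v ]→* r → p -[ u ++ v ]→* r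
  path-++ stop       π = π
  path-++ (step e ρ) π = step e (path-++ ρ π)

  stateAt : ∀ {p q w} → p -[ w ]→* q → Fin (suc (length w)) → State
  stateAt {p} π          zero    = p
  stateAt     (step _ π) (suc k) = stateAt π k

  initialSegment : ∀ {p q w} (π : p -[ w ]→* q) → All IsSend w → ∀ k →
                   ∃ λ v → All IsSend v × p -[ v ]→* stateAt π k
  initialSegment π          _        zero    = [] , [] , stop
  initialSegment (step e π) (s ∷ ss) (suc k) with initialSegment π ss k
  ... | v , sv , ρ = _ , s ∷ sv , step e ρ

  segment : ∀ {p q w} (π : p -[ w ]→* q) → All IsSend w → ∀ {j k} → j Fin.< k →
            ∃ λ v → v ≢ [] × All IsSend v × stateAt π j -[ v ]→* stateAt π k
  segment (step e π) (s ∷ ss) {zero}  {suc k} _ with initialSegment π ss k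
  ... | v , sv , ρ = _ , (λ ()) , s ∷ sv , step e ρ
  segment (step e π) (s ∷ ss) {suc j} {suc k} (s≤s j<k) = segment π ss j<k

  -- A path with `size` or more labels visits more than `size` states; two of them coincide, and the
  -- segment between them is a send cycle.
  sendPath-length : ¬ HasSendCycle → ∀ {p q w} → p -[ w ]→* q → All IsSend w → length w < size
  sendPath-length acyclic {w = w} π ss with length w <? size
  ... | yes w<size = w<size
  ... | no  w≮size with pigeonhole (s≤s (≮⇒≥ w≮size)) (stateAt π)
  ... | j , k , j<k , same with segment π ss j<k
  ... | v , v≢[] , sv , ρ =
    contradiction (_ , v , v≢[] , sv , subst (stateAt π j -[ v ]→*_) (sym same) ρ) acyclic

  -- Receptions cut the path into one more block of sends than there are receptions, and each block
  -- is shorter than `size`. The prefix `u` accumulates the block in progress.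
  sent-bound-from : ¬ HasSendCycle → ∀ {p q r u w} → p -[ u ]→* q → All IsSend u → q -[ w ]→* r →
                    length u + length (sent w) ≤ suc (length (received w)) * size
  sent-bound-from acyclic {u = u} ρ su stop = begin
    length u + 0 ≡⟨ +-identityʳ _ ⟩
    length u     ≤⟨ <⇒≤ (sendPath-length acyclic ρ su) ⟩
    size         ≤⟨ m≤m+n size 0 ⟩
    size + 0     ∎
    where open ≤-Reasoning hiding (stop)
  sent-bound-from acyclic {u = u} {w = (‵- b) ∷ w} ρ su (step e π) = begin
    length u + suc (length (sent w))             ≡⟨ +-suc _ _ ⟩
    suc (length u) + length (sent w)             ≡⟨ cong (_+ length (sent w)) (sym (length-∷ʳ (‵- b) u)) ⟩
    length (u ∷ʳ (‵- b)) + length (sent w)       ≤⟨ sent-bound-from acyclic (path-++ ρ (step e stop)) (Allₚ.∷ʳ⁺ su (isSend b)) π ⟩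
    suc (length (received w)) * size             ∎
    where open ≤-Reasoning hiding (stop)
  sent-bound-from acyclic ρ su (step {e = ‵+ b} e π) =
    +-mono-≤ (<⇒≤ (sendPath-length acyclic ρ su)) (sent-bound-from acyclic stop [] π)

  sent-bound : ¬ HasSendCycle → ∀ {p q w} → p -[ w ]→* q →
               length (sent w) ≤ suc (length (received w)) * size
  sent-bound acyclic = sent-bound-from acyclic stop []

  module _ (sr : IsSR) where
    open IsSR sr

    send-receive-exclusive : ∀ {p a b q r} → p -[ ‵- b ]→ q → p -[ ‵+ a ]→ r → ⊥
    send-receive-exclusive {p} s t with sendOrReceive p
    ... | inj₁ send = send _ _ t
    ... | inj₂ recv = recv _ _ s

    -- An SR-machine is a deterministic two-tape automaton: its run on a pair of
    -- words extends its run on any pair of prefixes.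
    residual : ∀ {p q r w v s t} → p -[ w ]→* q → p -[ v ]→* r →
               sent v ≡ sent w ++ s → received v ≡ received w ++ t →
               ∃ λ u → q -[ u ]→* r × sent u ≡ s × received u ≡ t
    residual stop π es er = _ , π , es , er
    residual (step {e = ‵- b} e ρ) (step {e = ‵- c} f π) es er with ∷-injective es
    ... | refl , es′ with deterministic _ _ _ _ e f
    ... | refl = residual ρ π es′ er
    residual (step {e = ‵- b} e ρ) (step {e = ‵+ c} f π) es er = contradiction f (send-receive-exclusive e)
    residual (step {e = ‵+ b} e ρ) (step {e = ‵- c} f π) es er = contradiction e (send-receive-exclusive f)
    residual (step {e = ‵+ b} e ρ) (step {e = ‵+ c} f π) es er with ∷-injective er
    ... | refl , er′ with deterministic _ _ _ _ e f
    ... | refl = residual ρ π es er′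

    -- The runs w and v can only separate at a send, hence after all of s has been sent.
    overtake : ∀ {p q r w v t y s s′} → p -[ w ]→* q → p -[ v ]→* r →
               received v ≡ received w ++ t → sent w ≡ s ++ y → sent v ≡ s ++ s′ →
               ∃ λ m → ∃ λ u → m -[ u ]→* r × length t ≤ length (received u) × length (sent u) ≤ length s′
    -- With `s` used up, all that remains of `v` serves as `u`: it still receives `t` and sends only
    -- `s′`.
    overtake {w = w} {v} {t} {s = []} ρ π er _ ev =
      _ , v , π , subst ((length t ≤_) ∘ length) (sym er) (length-++-≤ʳ t {received w}) , ≤-reflexive (cong length ev)
    overtake {t = t} {s = _ ∷ s} {s′} (step {e = ‵- b} e ρ) (step {e = ‵- c} f π) er ew ev
      with ∷-injective ew | ∷-injective ev
    ... | refl , ew′ | refl , ev′ with deterministic _ _ _ _ e f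
    ... | refl = overtake {t = t} {s = s} {s′} ρ π er ew′ ev′
    overtake {t = t} {s = _ ∷ s} {s′} (step {e = ‵- b} e ρ) (step {e = ‵+ c} f π) _ _ _ = contradiction f (send-receive-exclusive e)
    overtake {t = t} {s = _ ∷ s} {s′} (step {e = ‵+ b} e ρ) (step {e = ‵- c} f π) _ _ _ = contradiction e (send-receive-exclusive f)
    overtake {t = t} {s = _ ∷ s} {s′} (step {e = ‵+ b} e ρ) (step {e = ‵+ c} f π) er ew ev with ∷-injective er
    ... | refl , er′ with deterministic _ _ _ _ e f
    ... | refl = overtake {t = t} {s = _ ∷ s} {s′} ρ π er′ ew ev

-- Decidable questions about a single machine

module _ {o i : ℕ} (M : Machine o i) where
  open Machine M

  transition? : ∀ p e q → Dec (p -[ e ]→ q)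
  transition? p e q = T? (transition p e q)

  sendState? : ∀ p → Dec (SendState p)
  sendState? p = all? λ b → all? λ q → ¬? (transition? p (‵+ b) q)

  receiveState? : ∀ p → Dec (ReceiveState p)
  receiveState? p = all? λ b → all? λ q → ¬? (transition? p (‵- b) q)

  -- Sends are unconstrained and the path may end anywhere: strong connectivity later extends it to
  -- the initial state, so this concerns the possible inputs of completed runs.
  CanReceive : State → List (Fin i) → Set
  CanReceive p y = ∃ λ q → ∃ λ w → ∃ λ r → p -[ w ]→* q × received w ≡ y ++ r

  Send : State → State → Set
  Send p q = ∃ λ b → p -[ ‵- b ]→ q

  -- Before each reception only sends occur, so the word is consumed letter by letter, with a
  -- reachability search in the graph of send transitions for each letter.
  canReceive? : ∀ p y → Dec (CanReceive p y)
  canReceive? p []      = yes (p , [] , [] , stop , refl)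
  canReceive? p (b ∷ y) =
    map′ (λ (q , r , s , t , c) → join s t c) split
      (any? λ q → any? λ r → sends? p q ×-dec transition? q (‵+ b) r ×-dec canReceive? r y)
    where
    sends? : Decidable (Star Send)
    sends? = star? Finₚ._≟_ (λ p q → any? λ b → transition? p (‵- b) q) (allFin size) (λ _ → ∈-allFin _)

    join : ∀ {p q r} → Star Send p q → q -[ ‵+ b ]→ r → CanReceive r y → CanReceive p (b ∷ y)
    join ε t (q , w , z , π , eq) = q , _ , z , step t π , cong (b ∷_) eq
    join ((_ , e) ◅ s) t c with join s t c
    ... | q , w , z , π , eq = q , _ , z , step e π , eq

    split : ∀ {p} → CanReceive p (b ∷ y) → ∃ λ q → ∃ λ r → Star Send p q × q -[ ‵+ b ]→ r × CanReceive r y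
    split (q , (‵- c) ∷ w , z , step e π , eq) with split (q , w , z , π , eq)
    ... | _ , _ , s , t , c = _ , _ , (_ , e) ◅ s , t , c
    split (q , (‵+ c) ∷ w , z , step e π , eq) with ∷-injective eq
    ... | refl , eq′ = _ , _ , ε , e , q , w , z , π , eq′


-- The symmetry exchanging the two machines

swap : Protocol → Protocol
swap P = record { mα = mβ ; mβ = mα ; F₀ = F₁ ; F₁ = F₀ }
  where open Protocol P

module _ (P : Protocol) where
  open Protocol P

  swapState : GlobalState → Protocol.GlobalState (swap P)
  swapState ((p , q) , (x , y)) = (q , p) , (y , x)

  -- This is the inclusion of `Z₀` in `Z₁`. Applied to `swap P` it is the converse inclusion, so
  -- each argument is given for one direction only.
  Simulates : Set
  Simulates = ∀ {w} → F₀.initial F₀.-[ w ]→* F₀.initial →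
              ∃ λ v → F₁.initial F₁.-[ v ]→* F₁.initial × sent v ≡ received w × received v ≡ sent w

-- Joint executions and their histories

module _ (P : Protocol) where
  open Protocol P

  -- Equations between components, in place of an inductive family, make a step decidable; the steps
  -- of `F₁` are those of the swapped protocol.
  Move₀ : GlobalState → GlobalState → Set
  Move₀ ((p , q) , (x , y)) ((p′ , q′) , (x′ , y′)) = q ≡ q′ ×
    ((∃ λ b → p F₀.-[ ‵- b ]→ p′ × x′ ≡ x ∷ʳ b × y ≡ y′) ⊎
     (∃ λ b → p F₀.-[ ‵+ b ]→ p′ × x ≡ x′ × y ≡ b ∷ y′))

  move₀? : Decidable Move₀
  move₀? ((p , q) , (x , y)) ((p′ , q′) , (x′ , y′)) = (q Finₚ.≟ q′) ×-dec
    ((any? λ b → transition? F₀ p (‵- b) p′ ×-dec ≡-dec Finₚ._≟_ x′ (x ∷ʳ b) ×-dec ≡-dec Finₚ._≟_ y y′) ⊎-dec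
     (any? λ b → transition? F₀ p (‵+ b) p′ ×-dec ≡-dec Finₚ._≟_ x x′ ×-dec ≡-dec Finₚ._≟_ y (b ∷ y′)))

  -- What remains of a joint execution when the interleaving is forgotten: one run per machine, each
  -- channel holding what has been sent but not yet received.
  History : GlobalState → Set
  History ((p , q) , (x , y)) = ∃ λ w → ∃ λ v →
    F₀.initial F₀.-[ w ]→* p × F₁.initial F₁.-[ v ]→* q ×
    sent w ≡ received v ++ x × sent v ≡ received w ++ y

  history-move₀ : ∀ {g g′} → History g → Move₀ g g′ → History g′
  history-move₀ {_ , (x , y)} (w , v , ρ , π , ew , ev) (refl , inj₁ (b , e , refl , refl)) =
    w ∷ʳ (‵- b) , v , path-++ ρ (F₀.step e F₀.stop) , π , ew′ , ev′
    where
    open ≡-Reasoning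
    ew′ : sent (w ∷ʳ (‵- b)) ≡ received v ++ (x ∷ʳ b)
    ew′ = begin
      sent (w ∷ʳ (‵- b))        ≡⟨ sent-++ w _ ⟩
      sent w ∷ʳ b               ≡⟨ cong (_∷ʳ b) ew ⟩
      (received v ++ x) ∷ʳ b    ≡⟨ ++-assoc (received v) x _ ⟩
      received v ++ (x ∷ʳ b)    ∎
    ev′ : sent v ≡ received (w ∷ʳ (‵- b)) ++ y
    ev′ = trans ev (cong (_++ y) (sym (trans (received-++ w _) (++-identityʳ _))))
  history-move₀ {g′ = _ , (x , y)} (w , v , ρ , π , ew , ev) (refl , inj₂ (b , e , refl , refl)) =
    w ∷ʳ (‵+ b) , v , path-++ ρ (F₀.step e F₀.stop) , π ,
    trans (sent-++ w _) (trans (++-identityʳ _) ew) , ev′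
    where
    open ≡-Reasoning
    ev′ : sent v ≡ received (w ∷ʳ (‵+ b)) ++ y
    ev′ = begin
      sent v                         ≡⟨ ev ⟩
      received w ++ b ∷ y            ≡⟨ ∷ʳ-++ (received w) b y ⟨
      received w ∷ʳ b ++ y           ≡⟨ cong (_++ y) (received-++ w _) ⟨
      received (w ∷ʳ (‵+ b)) ++ y    ∎

  -- The completed run of `F₀` is a loop, so `F₁` has a loop on the same pair of words. By
  -- determinism that loop extends the run already made by `F₁`, and `u` is what is left of it.
  answer : Simulates P → F₁.IsSR → ∀ {p q x y w r} → History ((p , q) , (x , y)) →
           p F₀.-[ w ]→* F₀.initial → received w ≡ y ++ r →
           ∃ λ u → q F₁.-[ u ]→* F₁.initial × sent u ≡ r × received u ≡ x ++ sent w
  answer sim sr {x = x} {y} {w} {r} (w₀ , w₁ , ρ₀ , ρ₁ , e₀ , e₁) π er with sim (path-++ ρ₀ π)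
  ... | v , σ , sv , rv = residual sr ρ₁ σ
    (begin
      sent v                     ≡⟨ sv ⟩
      received (w₀ ++ w)         ≡⟨ received-++ w₀ w ⟩
      received w₀ ++ received w  ≡⟨ cong (received w₀ ++_) er ⟩
      received w₀ ++ (y ++ r)    ≡⟨ ++-assoc (received w₀) y r ⟨
      (received w₀ ++ y) ++ r    ≡⟨ cong (_++ r) e₁ ⟨
      sent w₁ ++ r               ∎)
    (begin
      received v                 ≡⟨ rv ⟩
      sent (w₀ ++ w)             ≡⟨ sent-++ w₀ w ⟩
      sent w₀ ++ sent w          ≡⟨ cong (_++ sent w) e₀ ⟩
      (received w₁ ++ x) ++ sent w ≡⟨ ++-assoc (received w₁) x _ ⟩
      received w₁ ++ (x ++ sent w) ∎)
    where open ≡-Reasoning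

  -- A bound on the channels, and local conditions for imitation

  module _ (sr₀ : F₀.IsSR) (sr₁ : F₁.IsSR) where

    homing : ∃ λ k → ∀ p → length (proj₁ (F₀.IsSR.stronglyConnected sr₀ p F₀.initial)) ≤ k
    homing = finite-bound _

    leaving : ∃ λ k → ∀ q → length (proj₁ (F₁.IsSR.stronglyConnected sr₁ F₁.initial q)) ≤ k
    leaving = finite-bound _

    -- The sum bounds the letters received by a suitable loop of `F₀`; the receptions separate
    -- blocks of at most `F₀.size` sends, one block more than there are receptions.
    channelBound : ℕ
    channelBound = suc (proj₁ leaving + proj₁ homing) * F₀.size

    -- Bring F₀ home along a short path and let F₁ imitate it. From some point on
    -- F₁ receives all of x while sending little; made into a loop and imitated by
    -- F₀, this sends at least |x| letters while receiving few.
    channel-bounded : Simulates P → Simulates (swap P) → ¬ F₀.HasSendCycle →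
                      ∀ {p q x y} → History ((p , q) , (x , y)) → length x ≤ channelBound
    channel-bounded sim sim′ acyclic {p} {x = x} (w₀ , w₁ , ρ₀ , ρ₁ , e₀ , e₁)
      with F₀.IsSR.stronglyConnected sr₀ p F₀.initial | proj₂ homing p
    ... | w , π | w≤ with sim (path-++ ρ₀ π)
    ... | v , σ , sv , rv
      -- Both `w₁` and `v` first send `received w₀`. Beyond that `v` sends only the short word
      -- `received w`, yet it receives `x ++ sent w` more than `w₁` does.
      with overtake sr₁ {t = x ++ sent w} {s = received w₀} {s′ = received w} ρ₁ σ
             (trans rv (trans (sent-++ w₀ w) (trans (cong (_++ sent w) e₀) (++-assoc (received w₁) x _))))
             e₁ (trans sv (received-++ w₀ w))
    ... | m , u , τ , x≤u , u≤w
      with F₁.IsSR.stronglyConnected sr₁ F₁.initial m | proj₂ leaving m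
    ... | l , λ₁ | l≤ with sim′ (path-++ λ₁ τ)
    ... | z , ζ , sz , rz = begin
      length x                                      ≤⟨ m≤m+n _ _ ⟩
      length x + length (sent w)                    ≡⟨ length-++ x ⟨
      length (x ++ sent w)                          ≤⟨ x≤u ⟩
      length (received u)                           ≤⟨ length-++-≤ʳ (received u) {received l} ⟩
      length (received l ++ received u)             ≡⟨ cong length (trans sz (received-++ l u)) ⟨
      length (sent z)                               ≤⟨ sent-bound acyclic ζ ⟩
      suc (length (received z)) * F₀.size           ≡⟨ cong (λ s → suc (length s) * F₀.size) (trans rz (sent-++ l u)) ⟩
      suc (length (sent l ++ sent u)) * F₀.size     ≡⟨ cong (λ k → suc k * F₀.size) (length-++ (sent l)) ⟩
      suc (length (sent l) + length (sent u)) * F₀.size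
        ≤⟨ *-monoˡ-≤ F₀.size (s≤s (+-mono-≤ (≤-trans (length-sent≤ l) l≤)
             (≤-trans u≤w (≤-trans (length-received≤ w) w≤)))) ⟩
      channelBound                                  ∎
      where open ≤-Reasoning hiding (stop)

  -- F₁ is able to imitate the next step of every completion of the run of F₀.
  Agrees : GlobalState → Set
  Agrees ((p , q) , (x , y)) =
    (F₁.SendState q → ∀ b → CanReceive F₀ p (y ∷ʳ b) → ∃ λ q′ → q F₁.-[ ‵- b ]→ q′) ×
    (F₁.ReceiveState q → ∀ a → head x ≡ just a → CanReceive F₀ p y → ∃ λ q′ → q F₁.-[ ‵+ a ]→ q′) ×
    -- The case where the run of `F₀` may stop: unless `F₁` waits with input still to read, it must
    -- be home as well, with nothing left in transit.
    (p ≡ F₀.initial → y ≡ [] → F₁.SendState q ⊎ x ≡ [] → x ≡ [] × q ≡ F₁.initial)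

  agrees? : ∀ g → Dec (Agrees g)
  agrees? ((p , q) , (x , y)) =
    (sendState? F₁ q →-dec all? λ b → canReceive? F₀ p (y ∷ʳ b) →-dec any? λ q′ → transition? F₁ q (‵- b) q′) ×-dec
    (receiveState? F₁ q →-dec all? λ a → Maybeₚ.≡-dec Finₚ._≟_ (head x) (just a) →-dec
       canReceive? F₀ p y →-dec any? λ q′ → transition? F₁ q (‵+ a) q′) ×-dec
    ((p Finₚ.≟ F₀.initial) →-dec ≡-dec Finₚ._≟_ y [] →-dec (sendState? F₁ q ⊎-dec ≡-dec Finₚ._≟_ x []) →-dec
       ≡-dec Finₚ._≟_ x [] ×-dec (q Finₚ.≟ F₁.initial))

  -- A path witnessing `CanReceive` is continued to the initial state and answered by `F₁`. The kind
  -- of state `q` and the words to be read force the first label of that answer, which is the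
  -- required transition.
  history⇒agrees : Simulates P → F₀.IsSR → F₁.IsSR → ∀ {g} → History g → Agrees g
  history⇒agrees sim sr₀ sr₁ {(p , q) , (x , y)} hist = sends , receives , ends
    where
    answerVia : ∀ {z} → CanReceive F₀ p (y ++ z) →
                ∃ λ u → ∃ λ r → ∃ λ s → q F₁.-[ u ]→* F₁.initial × sent u ≡ z ++ r × received u ≡ x ++ s
    answerVia {z} (m , w , r , π , er) with F₀.IsSR.stronglyConnected sr₀ m F₀.initial
    ... | v , σ with answer sim sr₁ {r = z ++ (r ++ received v)} hist (path-++ π σ)
                      (trans (received-++ w v) (trans (cong (_++ received v) er)
                        (trans (++-assoc (y ++ z) r _) (++-assoc y z _))))
    ... | u , τ , su , ru = u , _ , _ , τ , su , ru

    sends : F₁.SendState q → ∀ b → CanReceive F₀ p (y ∷ʳ b) → ∃ λ q′ → q F₁.-[ ‵- b ]→ q′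
    sends send b c with answerVia c
    ... | _ , _ , _ , F₁.step {e = ‵- _} e _ , refl , _ = _ , e
    ... | _ , _ , _ , F₁.step {e = ‵+ _} e _ , _ , _ = contradiction e (send _ _)

    receives : F₁.ReceiveState q → ∀ a → head x ≡ just a → CanReceive F₀ p y → ∃ λ q′ → q F₁.-[ ‵+ a ]→ q′
    receives recv a hx (m , w , r , π , er)
      with answerVia {z = []} (m , w , r , π , trans er (cong (_++ r) (sym (++-identityʳ y))))
    ... | _ , _ , s , π′ , _ , ru with trans (cong head ru) (head-++ x s hx) | π′
    ... | refl | F₁.step {e = ‵+ _} e _ = _ , e
    ... | _    | F₁.step {e = ‵- _} e _ = contradiction e (recv _ _)

    ends : p ≡ F₀.initial → y ≡ [] → F₁.SendState q ⊎ x ≡ [] → x ≡ [] × q ≡ F₁.initial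
    -- The empty path completes the run of `F₀`, so the answer sends nothing and receives exactly
    -- `x`; if nonempty, it starts with a reception, which `d` excludes.
    ends refl refl d with answer sim sr₁ {r = []} hist F₀.stop refl
    ... | _ , F₁.stop , _ , ru = trans (sym (++-identityʳ x)) (sym ru) , refl
    ... | _ , F₁.step {e = ‵+ _} e _ , su , ru with d
    ... | inj₁ send = contradiction e (send _ _)
    ... | inj₂ refl = contradiction ru λ ()

-- From local conditions to imitation

module _ (P : Protocol) where
  open Protocol P

  module _ (sr₀ : F₀.IsSR) (sr₁ : F₁.IsSR) {R : GlobalState → Set}
           (closed₀ : ∀ {g g′} → R g → Move₀ P g g′ → R g′)
           (closed₁ : ∀ {g g′} → R g → Move₀ (swap P) (swapState P g) (swapState P g′) → R g′)
           (live : ∀ {g} → R g → ¬ Deadlocked g)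
           (agrees : ∀ {g} → R g → Agrees P g) where

    Imitation : F₁.State → List (Fin mβ) → List (Fin mα) → Set
    Imitation q s t = ∃ λ v → q F₁.-[ v ]→* F₁.initial × sent v ≡ s × received v ≡ t

    mutual
      -- `F₁` has priority: it sends the next letter of `r` or receives the front of `x` as long as
      -- possible, and only then does `F₀` advance along `w`. The recursion is lexicographic, on `w`
      -- first and then on `r` and `x`.
      imitate : ∀ {p q} w r x y → p F₀.-[ w ]→* F₀.initial → R ((p , q) , (x , y)) →
                received w ≡ y ++ r → Imitation q r (x ++ sent w)
      imitate {q = q} w r x y π g er with F₁.IsSR.sendOrReceive sr₁ q
      imitate w []      x       y π g er | inj₁ send = advance w [] x y π g er (inj₁ (send , refl))
      imitate w (b ∷ r) x       y π g er | inj₁ send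
        with proj₁ (agrees g) send b (_ , w , r , π , trans er (sym (∷ʳ-++ y b r)))
      ... | q′ , e with imitate w r x (y ∷ʳ b) π (closed₁ g (refl , inj₁ (b , e , refl , refl)))
                                (trans er (sym (∷ʳ-++ y b r)))
      ... | v , σ , sv , rv = _ , F₁.step e σ , cong (b ∷_) sv , rv
      imitate w r       []      y π g er | inj₂ recv = advance w r [] y π g er (inj₂ (recv , refl))
      imitate w r       (a ∷ x) y π g er | inj₂ recv
        with proj₁ (proj₂ (agrees g)) recv a refl (_ , w , r , π , er)
      ... | q′ , e with imitate w r x y π (closed₁ g (refl , inj₂ (a , e , refl , refl))) er
      ... | v , σ , sv , rv = _ , F₁.step e σ , sv , cong (a ∷_) rv

      advance : ∀ {p q} w r x y → p F₀.-[ w ]→* F₀.initial → R ((p , q) , (x , y)) →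
                received w ≡ y ++ r → F₁.SendState q × r ≡ [] ⊎ F₁.ReceiveState q × x ≡ [] →
                Imitation q r (x ++ sent w)
      advance [] [] x [] F₀.stop g er d with proj₂ (proj₂ (agrees g)) refl refl (Sum.map proj₁ proj₂ d)
      ... | refl , refl = [] , F₁.stop , refl , refl
      advance ((‵- b) ∷ w) r x y (F₀.step e π) g er d
        with imitate w r (x ∷ʳ b) y π (closed₀ g (refl , inj₁ (b , e , refl , refl))) er
      ... | v , σ , sv , rv = v , σ , sv , trans rv (∷ʳ-++ x b (sent w))
      advance ((‵+ b) ∷ w) r x (c ∷ y) (F₀.step e π) g er d with ∷-injective er
      ... | refl , er′ = imitate w r x y π (closed₀ g (refl , inj₂ (b , e , refl , refl))) er′
      -- As `r` is nonempty, `F₁` must be waiting on an empty channel; `F₀` waits on one too, so the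
      -- state is deadlocked.
      advance {p} ((‵+ b) ∷ w) (c ∷ r) x [] (F₀.step e π) g er (inj₂ (recv , refl))
        with F₀.IsSR.sendOrReceive sr₀ p
      ... | inj₁ send  = contradiction e (send _ _)
      ... | inj₂ stuck = contradiction (stuck , recv , refl , refl) (live g)

    simulates : R initialState → Simulates P
    simulates g {w} π = imitate w (received w) [] [] π g refl

-- The decision procedure

module _ (P : Protocol) where
  open Protocol P

  affine⇒simulates : Affine → Simulates P
  affine⇒simulates affine {w} π with Equivalence.to (affine (sent w) (received w)) (w , π , refl , refl)
  ... | v , σ , rv , sv = v , σ , sv , rv

  affine⇒simulates-swap : Affine → Simulates (swap P)
  affine⇒simulates-swap affine {w} π with Equivalence.from (affine (received w) (sent w)) (w , π , refl , refl)
  ... | v , σ , sv , rv = v , σ , sv , rv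

  simulates⇒affine : Simulates P → Simulates (swap P) → Affine
  simulates⇒affine sim sim′ x y = mk⇔ to from
    where
    to : Z₀ x y → Z₁ x y
    to (w , π , refl , refl) with sim π
    ... | v , σ , sv , rv = v , σ , rv , sv
    from : Z₁ x y → Z₀ x y
    from (w , π , refl , refl) with sim′ π
    ... | v , σ , sv , rv = v , σ , sv , rv

  Move : GlobalState → GlobalState → Set
  Move g g′ = Move₀ P g g′ ⊎ Move₀ (swap P) (swapState P g) (swapState P g′)

  move⇒⟶ : ∀ {g g′} → Move g g′ → g ⟶ g′
  move⇒⟶ (inj₁ (refl , inj₁ (_ , e , refl , refl))) = send₀ e
  move⇒⟶ (inj₁ (refl , inj₂ (_ , e , refl , refl))) = recv₀ e
  move⇒⟶ (inj₂ (refl , inj₁ (_ , e , refl , refl))) = send₁ e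
  move⇒⟶ (inj₂ (refl , inj₂ (_ , e , refl , refl))) = recv₁ e

  ⟶⇒move : ∀ {g g′} → g ⟶ g′ → Move g g′
  ⟶⇒move (send₀ e) = inj₁ (refl , inj₁ (_ , e , refl , refl))
  ⟶⇒move (recv₀ e) = inj₁ (refl , inj₂ (_ , e , refl , refl))
  ⟶⇒move (send₁ e) = inj₂ (refl , inj₁ (_ , e , refl , refl))
  ⟶⇒move (recv₁ e) = inj₂ (refl , inj₂ (_ , e , refl , refl))

  history-swap : ∀ {g} → History P g → History (swap P) (swapState P g)
  history-swap (w , v , ρ , π , ew , ev) = v , w , π , ρ , ev , ew

  history-unswap : ∀ {g} → History (swap P) (swapState P g) → History P g
  history-unswap (w , v , ρ , π , ew , ev) = v , w , π , ρ , ev , ew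

  history-move : ∀ {g g′} → History P g → Move g g′ → History P g′
  history-move h (inj₁ m) = history-move₀ P h m
  history-move h (inj₂ m) = history-unswap (history-move₀ (swap P) (history-swap h) m)

  Fits : ℕ → GlobalState → Set
  Fits l (_ , (x , y)) = length x ≤ l × length y ≤ l

  fits? : ∀ l g → Dec (Fits l g)
  fits? l (_ , (x , y)) = (length x ≤? l) ×-dec (length y ≤? l)

  fits-move : ∀ {l g g′} → Fits l g → Move g g′ → Fits (suc l) g′
  fits-move {g = _ , (x , y)} (x≤ , y≤) (inj₁ (refl , inj₁ (b , e , refl , refl))) =
    subst (_≤ _) (sym (length-∷ʳ b x)) (s≤s x≤) , m≤n⇒m≤1+n y≤
  fits-move (x≤ , y≤) (inj₁ (refl , inj₂ (b , e , refl , refl))) = m≤n⇒m≤1+n x≤ , m≤n⇒m≤1+n (<⇒≤ y≤)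
  fits-move {g = _ , (x , y)} (x≤ , y≤) (inj₂ (refl , inj₁ (b , e , refl , refl))) =
    m≤n⇒m≤1+n x≤ , subst (_≤ _) (sym (length-∷ʳ b y)) (s≤s y≤)
  fits-move (x≤ , y≤) (inj₂ (refl , inj₂ (b , e , refl , refl))) = m≤n⇒m≤1+n (<⇒≤ x≤) , m≤n⇒m≤1+n y≤

  deadlocked? : ∀ g → Dec (Deadlocked g)
  deadlocked? ((p , q) , (x , y)) =
    receiveState? F₀ p ×-dec receiveState? F₁ q ×-dec ≡-dec Finₚ._≟_ x [] ×-dec ≡-dec Finₚ._≟_ y []

  -- Bounding the target makes the set of edge targets finite, which is all that the search
  -- requires.
  Edge : ℕ → GlobalState → GlobalState → Set
  Edge l g g′ = Move g g′ × Fits l g′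

  edge? : ∀ l → Decidable (Edge l)
  edge? l g g′ = (move₀? P g g′ ⊎-dec move₀? (swap P) (swapState P g) (swapState P g′)) ×-dec fits? l g′

  configurations : ℕ → List GlobalState
  configurations l = cartesianProduct (cartesianProduct (allFin _) (allFin _))
                                      (cartesianProduct (lists≤ _ l) (lists≤ _ l))

  ∈-configurations : ∀ {l} g → Fits l g → g ∈ configurations l
  ∈-configurations ((p , q) , (x , y)) (x≤ , y≤) =
    ∈-cartesianProduct⁺ (∈-cartesianProduct⁺ (∈-allFin p) (∈-allFin q))
                        (∈-cartesianProduct⁺ (∈-lists≤ x x≤) (∈-lists≤ y y≤))

  _≟-global_ : DecidableEquality GlobalState
  _≟-global_ = Productₚ.≡-dec (Productₚ.≡-dec Finₚ._≟_ Finₚ._≟_)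
                              (Productₚ.≡-dec (≡-dec Finₚ._≟_) (≡-dec Finₚ._≟_))

  ReachableWithin : ℕ → GlobalState → Set
  ReachableWithin l = Star (Edge l) initialState

  reachableWithin? : ∀ l g → Dec (ReachableWithin l g)
  reachableWithin? l = star? _≟-global_ (edge? l) (configurations l) (λ (_ , fits) → ∈-configurations _ fits) initialState

  Sound : ℕ → GlobalState → Set
  Sound l g = Fits l g × ¬ Deadlocked g × Agrees P g × Agrees (swap P) (swapState P g)

  sound? : ∀ l g → Dec (Sound l g)
  sound? l g = fits? l g ×-dec ¬? (deadlocked? g) ×-dec agrees? P g ×-dec agrees? (swap P) (swapState P g)

  -- One letter of slack beyond l makes an overflow of l visible to the search.
  AllSound : ℕ → Set
  AllSound l = ∀ g → ReachableWithin (suc l) g → Sound l g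

  allSound? : ∀ l → Dec (AllSound l)
  allSound? l = map′ (λ sound g r → All.lookup sound (∈-configurations g (fits r)) r) (λ sound → All.tabulate λ {g} _ → sound g)
    (All.all? (λ g → reachableWithin? (suc l) g →-dec sound? l g) (configurations (suc l)))
    where
    fits-star : ∀ {g g′} → Fits (suc l) g → Star (Edge (suc l)) g g′ → Fits (suc l) g′
    fits-star f ε              = f
    fits-star _ ((_ , f) ◅ es) = fits-star f es
    fits : ∀ {g} → ReachableWithin (suc l) g → Fits (suc l) g
    fits = fits-star (z≤n , z≤n)

  module _ (sr₀ : F₀.IsSR) (sr₁ : F₁.IsSR) where

    -- Soundness keeps every state found within `l`, so its successors stay within `suc l` and the
    -- search misses no reachable state. The states found thus form an invariant, to which
    -- `simulates` applies in both directions.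
    allSound⇒affine×deadlockFree : ∀ {l} → AllSound l → Affine × DeadlockFree
    allSound⇒affine×deadlockFree {l} sound =
      simulates⇒affine
        (simulates P sr₀ sr₁ (λ r m → extend r (inj₁ m)) (λ r m → extend r (inj₂ m)) live
          (λ r → proj₁ (proj₂ (proj₂ (sound _ r)))) ε)
        (simulates (swap P) sr₁ sr₀ {R = λ g → ReachableWithin (suc l) (swapState (swap P) g)}
          (λ r m → extend r (inj₂ m)) (λ r m → extend r (inj₁ m))
          (λ r (d₁ , d₀ , ey , ex) → live r (d₀ , d₁ , ex , ey))
          (λ r → proj₂ (proj₂ (proj₂ (sound _ r)))) ε)
      , λ g r → live (within ε r)
      where
      extend : ∀ {g g′} → ReachableWithin (suc l) g → Move g g′ → ReachableWithin (suc l) g′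
      extend r m = r ◅◅ ((m , fits-move (proj₁ (sound _ r)) m) ◅ ε)
      live : ∀ {g} → ReachableWithin (suc l) g → ¬ Deadlocked g
      live r = proj₁ (proj₂ (sound _ r))
      within : ∀ {g g′} → ReachableWithin (suc l) g → Star _⟶_ g g′ → ReachableWithin (suc l) g′
      within r ε       = r
      within r (s ◅ t) = within (extend r (⟶⇒move s)) t

    -- Every state found is truly reachable and has a history; the history yields the local
    -- conditions and a bound on each channel, whence the maximum of two bounds.
    affine×deadlockFree⇒allSound : ¬ F₀.HasSendCycle → ¬ F₁.HasSendCycle → Affine × DeadlockFree →
      AllSound (channelBound P sr₀ sr₁ ⊔ channelBound (swap P) sr₁ sr₀)
    affine×deadlockFree⇒allSound acyclic₀ acyclic₁ (affine , free) g r =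
      ( m≤n⇒m≤n⊔o _ (channel-bounded P sr₀ sr₁ sim sim′ acyclic₀ hist)
      , m≤n⇒m≤o⊔n _ (channel-bounded (swap P) sr₁ sr₀ sim′ sim acyclic₁ (history-swap hist)) ) ,
      free g (Star.map (move⇒⟶ ∘ proj₁) r) ,
      history⇒agrees P sim sr₀ sr₁ hist ,
      history⇒agrees (swap P) sim′ sr₁ sr₀ (history-swap hist)
      where
      sim : Simulates P
      sim = affine⇒simulates affine
      sim′ : Simulates (swap P)
      sim′ = affine⇒simulates-swap affine
      follow : ∀ {l g g′} → History P g → Star (Edge l) g g′ → History P g′
      follow h ε              = h
      follow h ((m , _) ◅ es) = follow (history-move h m) es
      hist : History P g
      hist = follow ([] , [] , F₀.stop , F₁.stop , refl , refl) r

theorem6p5 : (P : Protocol) → let open Protocol P in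
    F₀.IsSR → F₁.IsSR → ¬ F₀.HasSendCycle → ¬ F₁.HasSendCycle →
    Dec (Affine × DeadlockFree)
theorem6p5 P sr₀ sr₁ acyclic₀ acyclic₁ =
  map′ (allSound⇒affine×deadlockFree P sr₀ sr₁)
       (affine×deadlockFree⇒allSound P sr₀ sr₁ acyclic₀ acyclic₁)
       -- The omitted bound is fixed by the completeness direction; the soundness direction holds
       -- for every bound.
       (allSound? P _)
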